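{- The elementary abelian group $(\mathbb{Z}_3)^{10}$ is not a CI group.
   Context: Let $G$ be a finite group. For a subset $S \subseteq G$ with $S = S^{ -1}$ (a symmetric subset), the Cayley graph $\mathrm{Cay}(G;S)$ is the undirected graph with vertex set $G$ in which $g$ and $h$ are adjacent if and only if $h \in Sg$ (loops are allowed, i.e. $S$ may contain the identity). A Cayley graph $\mathrm{Cay}(G;S)$ is a CI graph if, for every symmetric subset $S'$ of $G$ such that $\mathrm{Cay}(G;S) \cong \mathrm{Cay}(G;S')$, there is a group automorphism $\alpha$ of $G$ with $\alpha(S)=S'$. $G$ is a CI group if every Cayley graph of $G$ is a CI graph. -}

module Defs where

open import Level using (Level; 0ℓ; _⊔_) renaming (suc to lsuc)
open import Algebra.Bundles using (Group; AbelianGroup)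
open import Algebra.Construct.Pointwise using () renaming (abelianGroup to pointwise)
open import Algebra.Definitions using (Associative; Commutative; LeftIdentity; LeftInverse)
open import Algebra.Morphism.Structures using (module GroupMorphisms)
import Algebra.Consequences.Propositional as Consequences
open import Data.Fin.Base using (Fin; zero; suc; toℕ; finToFun; funToFin; combine)
open import Data.Fin.Properties using (toℕ-injective; toℕ-fromℕ<; toℕ<n; toℕ≤n; finToFun-funToFin; funToFin-finToFin)
open import Data.Nat.Base using (ℕ; zero; suc; NonZero; _+_; _∸_; _^_; _%_)
open import Data.Nat.DivMod using (_mod_; m%n<n; m%n%n≡m%n; %-distribˡ-+; m<n⇒m%n≡m; n%n≡0; m*n%n≡0)
open import Data.Nat.Properties using (+-assoc; +-comm; m∸n+n≡m)
open import Data.Product.Base using (∃; ∃-syntax; _×_; _,_; proj₂)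
open import Function.Bundles using (Inverse)
open import Relation.Binary.Bundles using (Setoid)
open import Relation.Binary.Core using (Rel)
open import Relation.Binary.Definitions using (Symmetric; _Respects₂_)
open import Relation.Binary.Morphism.Structures using (IsOrderIsomorphism)
open import Relation.Binary.PropositionalEquality as ≡ using (_≡_; _≗_; refl; cong; cong₂; sym; trans; module ≡-Reasoning)
open import Relation.Unary using (Pred; _∈_; _≐_; Decidable)

private
  variable
    c ℓ : Level

record FiniteGroup c ℓ : Set (lsuc (c ⊔ ℓ)) where
  field
    group       : Group c ℓ
    order       : ℕ
    enumeration : Inverse (≡.setoid (Fin order)) (Group.setoid group)

  open Group group public
    renaming (refl to ≈-refl; sym to ≈-sym; trans to ≈-trans)

-- Undirected graphs; loops are allowed, since adjacency is not required to be
-- irreflexive.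
record Graph v e a : Set (lsuc (v ⊔ e ⊔ a)) where
  field
    vertices : Setoid v e

  open Setoid vertices public using (_≈_) renaming (Carrier to Vertex)

  field
    Adjacent          : Rel Vertex a
    symmetric         : Symmetric Adjacent
    adjacent-respects : Adjacent Respects₂ _≈_

infix 4 _≅_

-- IsOrderIsomorphism assumes nothing of its relations: it says that f is a
-- bijection of the vertices which preserves and reflects adjacency.
_≅_ : ∀ {v e a} → Graph v e a → Graph v e a → Set (v ⊔ e ⊔ a)
Γ ≅ Δ = ∃ λ f → IsOrderIsomorphism Γ._≈_ Δ._≈_ Γ.Adjacent Δ.Adjacent f
  where
  module Γ = Graph Γ
  module Δ = Graph Δ

module _ (G : FiniteGroup c ℓ) where
  open FiniteGroup G

  Image : (Carrier → Carrier) → Pred Carrier ℓ → Pred Carrier (c ⊔ ℓ)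
  Image f S y = ∃[ x ] x ∈ S × y ≈ f x

  -- Membership is decidable, as it is classically for any subset of a finite
  -- set, and does not depend on the chosen representative.
  record SymmetricSubset : Set (c ⊔ lsuc ℓ) where
    field
      members   : Pred Carrier ℓ
      respects  : ∀ {x y} → x ≈ y → x ∈ members → y ∈ members
      decidable : Decidable members
      symmetric : members ≐ Image _⁻¹ members

  open SymmetricSubset

  CayleyAdjacent : SymmetricSubset → Rel Carrier (c ⊔ ℓ)
  CayleyAdjacent S g h = ∃[ s ] s ∈ members S × h ≈ s ∙ g

  private
    inverse-closed : ∀ S {s} → s ∈ members S → s ⁻¹ ∈ members S
    inverse-closed S {s} s∈S = proj₂ (symmetric S) (s , s∈S , ≈-refl)

    adjacent-sym : ∀ S → Symmetric (CayleyAdjacent S)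
    adjacent-sym S {g} {h} (s , s∈S , h≈sg) = s ⁻¹ , inverse-closed S s∈S , (begin
      g                ≈⟨ identityˡ g ⟨
      ε ∙ g            ≈⟨ ∙-congʳ (inverseˡ s) ⟨
      (s ⁻¹ ∙ s) ∙ g   ≈⟨ assoc (s ⁻¹) s g ⟩
      s ⁻¹ ∙ (s ∙ g)   ≈⟨ ∙-congˡ h≈sg ⟨
      s ⁻¹ ∙ h         ∎)
      where open import Relation.Binary.Reasoning.Setoid setoid

  Cay : SymmetricSubset → Graph c ℓ (c ⊔ ℓ)
  Cay S = record
    { vertices          = setoid
    ; Adjacent          = CayleyAdjacent S
    ; symmetric         = adjacent-sym S
    ; adjacent-respects =
        (λ h≈h′ (s , s∈S , h≈sg) → s , s∈S , ≈-trans (≈-sym h≈h′) h≈sg) ,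
        (λ g≈g′ (s , s∈S , h≈sg) → s , s∈S , ≈-trans h≈sg (∙-congˡ g≈g′))
    }

  IsAutomorphism : (Carrier → Carrier) → Set (c ⊔ ℓ)
  IsAutomorphism = GroupMorphisms.IsGroupIsomorphism rawGroup rawGroup

  IsCIGraph : SymmetricSubset → Set (c ⊔ lsuc ℓ)
  IsCIGraph S = ∀ S′ → Cay S ≅ Cay S′ →
    ∃[ α ] IsAutomorphism α × Image α (members S) ≐ members S′

  IsCIGroup : Set (c ⊔ lsuc ℓ)
  IsCIGroup = ∀ S → IsCIGraph S

module _ (n : ℕ) .{{_ : NonZero n}} where

  private
    _⊕_ : Fin n → Fin n → Fin n
    i ⊕ j = (toℕ i + toℕ j) mod n

    ⊖_ : Fin n → Fin n
    ⊖ i = (n ∸ toℕ i) mod n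

    𝟘 : Fin n
    𝟘 = 0 mod n

    toℕ-mod : ∀ m → toℕ (m mod n) ≡ m % n
    toℕ-mod m = toℕ-fromℕ< (m%n<n m n)

    %-absorbˡ : ∀ a b → (a % n + b) % n ≡ (a + b) % n
    %-absorbˡ a b = begin
      (a % n + b) % n           ≡⟨ %-distribˡ-+ (a % n) b n ⟩
      (a % n % n + b % n) % n   ≡⟨ cong (λ x → (x + b % n) % n) (m%n%n≡m%n a n) ⟩
      (a % n + b % n) % n       ≡⟨ %-distribˡ-+ a b n ⟨
      (a + b) % n               ∎
      where open ≡-Reasoning

    mod-absorbˡ : ∀ a b → (toℕ (a mod n) + b) mod n ≡ (a + b) mod n
    mod-absorbˡ a b = toℕ-injective (begin
      toℕ ((toℕ (a mod n) + b) mod n)   ≡⟨ toℕ-mod _ ⟩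
      (toℕ (a mod n) + b) % n           ≡⟨ cong (λ x → (x + b) % n) (toℕ-mod a) ⟩
      (a % n + b) % n                   ≡⟨ %-absorbˡ a b ⟩
      (a + b) % n                       ≡⟨ toℕ-mod _ ⟨
      toℕ ((a + b) mod n)               ∎)
      where open ≡-Reasoning

    ⊕-comm : Commutative _≡_ _⊕_
    ⊕-comm i j = cong (_mod n) (+-comm (toℕ i) (toℕ j))

    ⊕-assoc : Associative _≡_ _⊕_
    ⊕-assoc i j k = begin
      (i ⊕ j) ⊕ k                           ≡⟨ mod-absorbˡ (toℕ i + toℕ j) (toℕ k) ⟩
      (toℕ i + toℕ j + toℕ k) mod n         ≡⟨ cong (_mod n) (+-assoc (toℕ i) (toℕ j) (toℕ k)) ⟩
      (toℕ i + (toℕ j + toℕ k)) mod n       ≡⟨ cong (_mod n) (+-comm (toℕ i) (toℕ j + toℕ k)) ⟩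
      (toℕ j + toℕ k + toℕ i) mod n         ≡⟨ mod-absorbˡ (toℕ j + toℕ k) (toℕ i) ⟨
      (j ⊕ k) ⊕ i                           ≡⟨ ⊕-comm (j ⊕ k) i ⟩
      i ⊕ (j ⊕ k)                           ∎
      where open ≡-Reasoning

    ⊕-identityˡ : LeftIdentity _≡_ 𝟘 _⊕_
    ⊕-identityˡ i = trans (mod-absorbˡ 0 (toℕ i))
      (toℕ-injective (trans (toℕ-mod (toℕ i)) (m<n⇒m%n≡m (toℕ<n i))))

    ⊕-inverseˡ : LeftInverse _≡_ 𝟘 ⊖_ _⊕_
    ⊕-inverseˡ i = begin
      (⊖ i) ⊕ i                     ≡⟨ mod-absorbˡ (n ∸ toℕ i) (toℕ i) ⟩
      (n ∸ toℕ i + toℕ i) mod n     ≡⟨ cong (_mod n) (m∸n+n≡m (toℕ≤n i)) ⟩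
      n mod n                       ≡⟨ toℕ-injective n-mod-n ⟩
      𝟘                             ∎
      where
      open ≡-Reasoning

      n-mod-n : toℕ (n mod n) ≡ toℕ 𝟘
      n-mod-n = begin
        toℕ (n mod n)   ≡⟨ toℕ-mod n ⟩
        n % n           ≡⟨ n%n≡0 n ⟩
        0               ≡⟨ m*n%n≡0 0 n ⟨
        0 % n           ≡⟨ toℕ-mod 0 ⟨
        toℕ 𝟘           ∎

  ℤ/_ : AbelianGroup 0ℓ 0ℓ
  ℤ/_ = record
    { Carrier = Fin n
    ; _≈_     = _≡_
    ; _∙_     = _⊕_
    ; ε       = 𝟘
    ; _⁻¹     = ⊖_
    ; isAbelianGroup = record
      { isGroup = record
        { isMonoid = record
          { isSemigroup = record
            { isMagma = ≡.isMagma _⊕_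
            ; assoc   = ⊕-assoc
            }
          ; identity = Consequences.comm∧idˡ⇒id ⊕-comm ⊕-identityˡ
          }
        ; inverse = Consequences.comm∧invˡ⇒inv ⊕-comm ⊕-inverseˡ
        ; ⁻¹-cong = cong ⊖_
        }
      ; comm = ⊕-comm
      }
    }

private
  funToFin-cong : ∀ {k n} {f g : Fin k → Fin n} → f ≗ g → funToFin f ≡ funToFin g
  funToFin-cong {zero}  f≗g = refl
  funToFin-cong {suc k} f≗g = cong₂ combine (f≗g zero) (funToFin-cong (λ i → f≗g (suc i)))

[ℤ/_]^_ : (n k : ℕ) .{{_ : NonZero n}} → FiniteGroup 0ℓ 0ℓ
[ℤ/ n ]^ k = record
  { group       = AbelianGroup.group (pointwise (Fin k) (ℤ/ n))
  ; order       = n ^ k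
  ; enumeration = record
    { to        = finToFun
    ; from      = funToFin
    ; to-cong   = λ { refl _ → refl }
    ; from-cong = funToFin-cong
    ; inverse   =
        (λ { {f} refl → finToFun-funToFin f }) ,
        (λ {x} f≗x → trans (funToFin-cong f≗x) (funToFin-finToFin {k} {n} x))
    }
  }

{-# OPTIONS --safe #-}

-- Write a vector of (ℤ/3)¹⁰ as (a , b) with a ∈ (ℤ/3)⁴ and b ∈ (ℤ/3)⁶. Both
-- connection sets are cut out by affine conditions on b, imposed only when a is
-- 0, ± eⱼ or ± (1 - eᵢ). For φ : (ℤ/3)⁴ → (ℤ/3)⁶ the shear (a , b) ↦ (a , b + φ a)
-- carries Cay(S₀) to Cay(S₁) if, for each such a, the functionals on b which
-- occur in the conditions take on φ (x + a) - φ x the value by which S₁ is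
-- displaced from S₀, whatever x is. A cubic φ achieves this.
--
-- S₀ contains the subgroup (ℤ/3)⁴ × 0, and S₁ meets 0 × (ℤ/3)⁶ only in 0. So an
-- automorphism taking S₀ to S₁ takes (ℤ/3)⁴ × 0 to the graph of a linear map L
-- contained in S₁. The conditions say (L M)ᵢᵢ = 1 and (M L)ⱼⱼ = 0 for i , j ≤ 4,
-- where M = J - I is the 4 × 4 matrix with zero diagonal and ones elsewhere.
-- But tr (L M) = tr (M L), and 4 ≠ 0 in ℤ/3.
module Submission where

open import Defs
open import Algebra.Bundles using (Group; AbelianGroup)
open import Algebra.Definitions.RawMonoid using (sum)
open import Algebra.Morphism.Structures using (module GroupMorphisms)
import Algebra.Properties.AbelianGroup as AbelianGroupProperties
import Algebra.Properties.CommutativeMonoid.Sum as CommutativeMonoidSum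
import Algebra.Properties.CommutativeSemigroup as CommutativeSemigroupProperties
import Algebra.Properties.Group as GroupProperties
open import Data.Bool.Base using (if_then_else_)
open import Data.Empty using (⊥)
open import Data.Fin.Base using (Fin; zero; suc; toℕ; _↑ˡ_; _↑ʳ_; punchOut; join; splitAt)
open import Data.Fin.Properties using (all?; any?; _≟_; join-splitAt; punchOut-injective; <⇒notInjective)
open import Data.Nat.Base using (ℕ; zero; suc; nonZero; _*_) renaming (_+_ to _+ⁿ_)
open import Data.Nat.DivMod using (_mod_)
open import Data.Nat.Properties using (n<1+n)
open import Data.Product.Base using (∃; _×_; _,_; proj₁; proj₂)
open import Data.Sum.Base using ([_,_])
open import Data.Vec.Base using (Vec; []; _∷_; lookup; tabulate)
open import Data.Vec.Functional using (_++_; replicate)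
open import Data.Vec.Functional.Properties using (lookup-++ˡ; lookup-++ʳ; ++-cong)
open import Data.Vec.Properties using (lookup∘tabulate)
open import Function.Base using (_∘_)
open import Function.Bundles using (Inverse)
open import Function.Definitions using (Injective; Congruent)
open import Relation.Binary.PropositionalEquality using (_≡_; _≗_; refl; sym; trans; cong; cong₂; subst; module ≡-Reasoning)
open import Relation.Nullary.Decidable using (Dec; yes; no; does; map′; from-yes; _×-dec_; _→-dec_)
open import Relation.Nullary.Negation.Core using (¬_; contradiction)
open import Relation.Unary using (Decidable)

-- Pigeonhole, homomorphisms and exhaustive search

private
  variable
    m n : ℕ

-- If `j` were missed, punching it out would inject `Fin (suc n)` into `Fin n`.
injective⇒surjective : {f : Fin n → Fin n} → Injective _≡_ _≡_ f → ∀ j → ∃ λ i → f i ≡ j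
injective⇒surjective {n = suc n} {f} inj j with any? (λ i → f i ≟ j)
... | yes hit  = hit
... | no  miss = contradiction
  (λ {x} {y} eq → inj (punchOut-injective (avoid x) (avoid y) eq))
  (<⇒notInjective {f = λ i → punchOut (avoid i)} (n<1+n n))
  where
  avoid : ∀ i → ¬ j ≡ f i
  avoid i j≡fi = miss (i , sym j≡fi)

module _ {c ℓ} (G : FiniteGroup c ℓ) where
  open FiniteGroup G
  open Inverse enumeration

  private
    from-injective : ∀ {x y} → from x ≡ from y → x ≈ y
    from-injective {x} {y} eq = ≈-trans (≈-sym (strictlyInverseˡ x))
      (≈-trans (to-cong eq) (strictlyInverseˡ y))

  -- The pigeonhole principle, carried along the enumeration. It makes the shear surjective without
  -- an explicit inverse and later supplies preimages of the unit vectors.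
  finite-injective⇒surjective : {f : Carrier → Carrier} → Congruent _≈_ _≈_ f →
    Injective _≈_ _≈_ f → ∀ y → ∃ λ x → f x ≈ y
  finite-injective⇒surjective {f} f-cong inj y
    with i , eq ← injective⇒surjective {f = λ i → from (f (to i))}
      (λ {i} {j} eq → trans (sym (strictlyInverseʳ i))
        (trans (from-cong (inj (from-injective eq))) (strictlyInverseʳ j)))
      (from y)
    = to i , from-injective eq

module _ {a b ℓ₁ ℓ₂} (G : Group a ℓ₁) (H : Group b ℓ₂) where
  private
    module G = Group G
    module H = Group H

  open GroupMorphisms G.rawGroup H.rawGroup

  sum-homo : {f : G.Carrier → H.Carrier} → IsGroupHomomorphism f → ∀ {n} (t : Fin n → G.Carrier) →
    f (sum G.rawMonoid t) H.≈ sum H.rawMonoid (f ∘ t)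
  sum-homo f-homo {zero}  t = IsGroupHomomorphism.ε-homo f-homo
  sum-homo f-homo {suc n} t = H.trans (IsGroupHomomorphism.homo f-homo _ _)
    (H.∙-congˡ (sum-homo f-homo (t ∘ suc)))

-- Over vectors the search works for any decidable predicate; over functions it would have to
-- respect pointwise equality.
allVec? : ∀ {p} {P : Vec (Fin m) n → Set p} → Decidable P → Dec (∀ xs → P xs)
allVec? {n = zero}  P? = map′ (λ { p [] → p }) (λ p → p []) (P? [])
allVec? {n = suc n} P? = map′ (λ { p (x ∷ xs) → p x xs }) (λ p x xs → p (x ∷ xs))
  (all? λ x → allVec? λ xs → P? (x ∷ xs))

-- Coordinates on (ℤ/3)¹⁰ and the cubic map

open AbelianGroup (ℤ/ 3) using (_-_)
  renaming (_∙_ to _+_; ε to 0#; _⁻¹ to -_; comm to +-comm;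
            identityˡ to +-identityˡ; identityʳ to +-identityʳ)
open AbelianGroupProperties (ℤ/ 3) using (//-rightDividesˡ; ⁻¹-∙-comm)
  renaming (∙-cancelʳ to +-cancelʳ)
open CommutativeSemigroupProperties (AbelianGroup.commutativeSemigroup (ℤ/ 3)) using (interchange)
open CommutativeMonoidSum (AbelianGroup.commutativeMonoid (ℤ/ 3)) using (∑-comm; ∑-distrib-+; sum-cong-≗)
  renaming (sum to ∑)

module A = FiniteGroup ([ℤ/ 3 ]^ 4)
module V where
  open FiniteGroup ([ℤ/ 3 ]^ 10) public
  open GroupProperties group public
    using (//-rightDividesˡ; y≈x\\z; ∙-cancelʳ; ⁻¹-involutive; x∙y⁻¹≈ε⇒x≈y)

𝔽₃ : Set
𝔽₃ = Fin 3

_·_ : 𝔽₃ → 𝔽₃ → 𝔽₃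
x · y = (toℕ x * toℕ y) mod 3

infixl 8 _·_

top : V.Carrier → A.Carrier
top v i = v (i ↑ˡ 6)

low : V.Carrier → Fin 6 → 𝔽₃
low v i = v (4 ↑ʳ i)

mid : V.Carrier → Fin 4 → 𝔽₃
mid v i = low v (i ↑ˡ 2)

-- Chosen so that φᵢ grows by 1 in the direction 1 - eᵢ, and the sum of the φᵢ
-- with i ≠ j does not change in the direction eⱼ.
cubic : 𝔽₃ → 𝔽₃ → 𝔽₃ → 𝔽₃ → 𝔽₃
cubic x y z w = z · (y + w) · (y + w) - s · (y · w + x · (x + s))
  where s = y + z + w

φ : A.Carrier → A.Carrier
φ x i = cubic (x i) (x (1 ↷ i)) (x (2 ↷ i)) (x (3 ↷ i))
  where
  _↷_ : ℕ → Fin 4 → Fin 4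
  k ↷ i = (k +ⁿ toℕ i) mod 4

φ-cong : ∀ {x y} → x ≗ y → φ x ≗ φ y
φ-cong x≗y i = cubic-cong (x≗y _) (x≗y _) (x≗y _) (x≗y _)
  where
  cubic-cong : ∀ {x x′ y y′ z z′ w w′} → x ≡ x′ → y ≡ y′ → z ≡ z′ → w ≡ w′ →
    cubic x y z w ≡ cubic x′ y′ z′ w′
  cubic-cong refl refl refl refl = refl

-- The last two coordinates only pad the dimension from 8 to 10.
Φ : A.Carrier → V.Carrier
Φ x = replicate 4 0# ++ (φ x ++ replicate 2 0#)

Φ-cong : ∀ {x y} → x ≗ y → Φ x V.≈ Φ y
Φ-cong {x} {y} x≗y = ++-cong (replicate 4 0#) (replicate 4 0#) (λ _ → refl)
  (++-cong (φ x) (φ y) (φ-cong x≗y) (λ _ → refl))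

top-Φ : ∀ x → top (Φ x) ≗ A.ε
top-Φ x i = lookup-++ˡ (replicate 4 0#) (φ x ++ replicate 2 0#) i

-- Affine conditions and the increments of φ

data Constraint : Set where
  origin : Fin 6 → Constraint
  axis   : Fin 4 → Constraint
  coaxis : Fin 4 → Constraint

unit : Fin 4 → A.Carrier
unit i j = if does (i ≟ j) then suc zero else zero

direction : Constraint → A.Carrier
direction (origin i) j = 0#
direction (axis i)   j = unit i j
direction (coaxis i) j = suc zero - unit i j

-- On the first four coordinates of b, `axis i` reads off (M b)ᵢ. Since 1 - eᵢ = M eᵢ, the
-- `coaxis i` value of L at its direction is (L M)ᵢᵢ.
functional : Constraint → V.Carrier → 𝔽₃
functional (origin i) v = low v i
functional (axis i)   v = ∑ (mid v) - mid v i
functional (coaxis i) v = mid v i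

jump : Constraint → 𝔽₃
jump (origin i) = zero
jump (axis i)   = zero
jump (coaxis i) = suc zero

functional-cong : ∀ k {u v} → u V.≈ v → functional k u ≡ functional k v
functional-cong (origin i) u≈v = u≈v _
functional-cong (axis i)   u≈v = cong₂ _-_ (sum-cong-≗ {4} λ j → u≈v (4 ↑ʳ (j ↑ˡ 2))) (u≈v (4 ↑ʳ (i ↑ˡ 2)))
functional-cong (coaxis i) u≈v = u≈v _

functional-homo : ∀ k u v → functional k (u V.∙ v) ≡ functional k u + functional k v
functional-homo (origin i) u v = refl
functional-homo (axis i)   u v = begin
  ∑ (mid (u V.∙ v)) - (mid u i + mid v i)
    ≡⟨ cong₂ _+_ (∑-distrib-+ (mid u) (mid v)) (sym (⁻¹-∙-comm (mid u i) (mid v i))) ⟩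
  (∑ (mid u) + ∑ (mid v)) + (- mid u i + - mid v i)
    ≡⟨ interchange (∑ (mid u)) (∑ (mid v)) (- mid u i) (- mid v i) ⟩
  (∑ (mid u) - mid u i) + (∑ (mid v) - mid v i) ∎
  where open ≡-Reasoning
functional-homo (coaxis i) u v = refl

Increment : Constraint → A.Carrier → Set
Increment k x = functional k (Φ (x A.∙ direction k)) ≡ functional k (Φ x) + jump k

Increment? : ∀ k x → Dec (Increment k x)
Increment? k x = _ ≟ _

Increment-cong : ∀ k {x y} → x ≗ y → Increment k x → Increment k y
Increment-cong k {x} {y} x≗y inc = begin
  functional k (Φ (y A.∙ direction k))
    ≡⟨ functional-cong k (Φ-cong λ i → cong (_+ direction k i) (x≗y i)) ⟨
  functional k (Φ (x A.∙ direction k))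
    ≡⟨ inc ⟩
  functional k (Φ x) + jump k
    ≡⟨ cong (_+ jump k) (functional-cong k (Φ-cong x≗y)) ⟩
  functional k (Φ y) + jump k ∎
  where open ≡-Reasoning

-- In the `origin` case nothing moves. The others are checked at all 81 points; `i` is quantified
-- inside the decided statement, so that the decision is a closed term and evaluates.
Φ-increment-vec : ∀ k (xs : Vec 𝔽₃ 4) → Increment k (lookup xs)
Φ-increment-vec (origin i) xs = trans
  (functional-cong (origin i) (Φ-cong {y = lookup xs} λ j → +-identityʳ (lookup xs j)))
  (sym (+-identityʳ _))
Φ-increment-vec (axis i)   = from-yes (all? λ i → allVec? λ xs → Increment? (axis i) (lookup xs)) i
Φ-increment-vec (coaxis i) = from-yes (all? λ i → allVec? λ xs → Increment? (coaxis i) (lookup xs)) i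

-- An arbitrary point agrees with the lookup of its tabulation only pointwise, hence the transfer by
-- `Increment-cong`.
Φ-increment : ∀ k x → Increment k x
Φ-increment k x = Increment-cong k (lookup∘tabulate x) (Φ-increment-vec k (tabulate x))

-- The two connection sets

Satisfies : (Constraint → 𝔽₃) → V.Carrier → Set
Satisfies κ v = ∀ k → top v ≗ direction k → functional k v ≡ κ k

Satisfies-resp : ∀ κ {u v} → u V.≈ v → Satisfies κ u → Satisfies κ v
Satisfies-resp κ u≈v sat k top≗ = trans (sym (functional-cong k u≈v))
  (sat k λ i → trans (u≈v _) (top≗ i))

satisfies? : ∀ κ → Decidable (Satisfies κ)
satisfies? κ v = map′
  (λ { (p , q , r) (origin i) → p i ; (p , q , r) (axis i) → q i ; (p , q , r) (coaxis i) → r i })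
  (λ p → p ∘ origin , p ∘ axis , p ∘ coaxis)
  (all? (each? ∘ origin) ×-dec all? (each? ∘ axis) ×-dec all? (each? ∘ coaxis))
  where
  each? : ∀ k → Dec (top v ≗ direction k → functional k v ≡ κ k)
  each? k = all? (λ i → top v i ≟ direction k i) →-dec (functional k v ≟ κ k)

-- Requiring the condition of `v` and of its inverse gives symmetry and accounts for the signs in ±
-- eⱼ and ± (1 - eᵢ). Vectors over all other nonzero points belong vacuously.
connection : (Constraint → 𝔽₃) → SymmetricSubset ([ℤ/ 3 ]^ 10)
connection κ = record
  { members   = λ v → Satisfies κ v × Satisfies κ (v V.⁻¹)
  ; respects  = λ {u} {v} → resp {u} {v}
  ; decidable = λ v → satisfies? κ v ×-dec satisfies? κ (v V.⁻¹)
  ; symmetric =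
      (λ {v} (p , q) → v V.⁻¹ , (q , Satisfies-resp κ (V.≈-sym (V.⁻¹-involutive v)) p) , V.≈-sym (V.⁻¹-involutive v)) ,
      (λ {v} (u , (p , q) , v≈u⁻¹) → resp {u V.⁻¹} {v} (V.≈-sym v≈u⁻¹)
        (q , Satisfies-resp κ (V.≈-sym (V.⁻¹-involutive u)) p))
  }
  where
  resp : ∀ {u v} → u V.≈ v → Satisfies κ u × Satisfies κ (u V.⁻¹) → Satisfies κ v × Satisfies κ (v V.⁻¹)
  resp u≈v (p , q) = Satisfies-resp κ u≈v p , Satisfies-resp κ (V.⁻¹-cong u≈v) q

S₀ S₁ : SymmetricSubset ([ℤ/ 3 ]^ 10)
S₀ = connection λ _ → 0#
S₁ = connection jump

-- The shear as a graph isomorphism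

shear : V.Carrier → V.Carrier
shear v = v V.∙ Φ (top v)

top-shear : ∀ v → top (shear v) ≗ top v
top-shear v i = trans (cong (top v i +_) (top-Φ (top v) i)) (+-identityʳ (top v i))

-- The shear fixes the first block, so both sides are the difference of `top h` and `top g`.
top-difference : ∀ {s t g h} → h V.≈ s V.∙ g → shear h V.≈ t V.∙ shear g → top t ≗ top s
top-difference {s} {t} {g} {h} h≈sg fh≈tfg i = +-cancelʳ (top g i) (top t i) (top s i) (begin
  top t i + top g i           ≡⟨ cong (top t i +_) (top-shear g i) ⟨
  top t i + top (shear g) i   ≡⟨ fh≈tfg (i ↑ˡ 6) ⟨
  top (shear h) i             ≡⟨ top-shear h i ⟩
  top h i                     ≡⟨ h≈sg (i ↑ˡ 6) ⟩
  top s i + top g i           ∎)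
  where open ≡-Reasoning

-- Shearing adds `Φ (top h)` minus `Φ (top g)` to the difference `s`. As `top h` is `top g` plus
-- `direction k`, `Φ-increment` evaluates `functional k` on this.
functional-difference : ∀ k {s t g h} → h V.≈ s V.∙ g → shear h V.≈ t V.∙ shear g →
  top s ≗ direction k → functional k t ≡ functional k s + jump k
functional-difference k {s} {t} {g} {h} h≈sg fh≈tfg top≗ =
  +-cancelʳ (functional k (shear g)) _ _ (begin
    functional k t + functional k (shear g)
      ≡⟨ functional-homo k t (shear g) ⟨
    functional k (t V.∙ shear g)
      ≡⟨ functional-cong k fh≈tfg ⟨
    functional k (shear h)
      ≡⟨ functional-homo k h (Φ (top h)) ⟩
    functional k h + functional k (Φ (top h))
      ≡⟨ cong₂ _+_ (trans (functional-cong k h≈sg) (functional-homo k s g)) Φ-top-h ⟩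
    (functional k s + functional k g) + (jump k + functional k (Φ (top g)))
      ≡⟨ interchange (functional k s) (functional k g) (jump k) (functional k (Φ (top g))) ⟩
    (functional k s + jump k) + (functional k g + functional k (Φ (top g)))
      ≡⟨ cong ((functional k s + jump k) +_) (functional-homo k g (Φ (top g))) ⟨
    (functional k s + jump k) + functional k (shear g) ∎)
  where
  open ≡-Reasoning

  top-h : top h ≗ top g A.∙ direction k
  top-h i = trans (h≈sg (i ↑ˡ 6))
    (trans (cong (_+ top g i) (top≗ i)) (+-comm (direction k i) (top g i)))

  Φ-top-h : functional k (Φ (top h)) ≡ jump k + functional k (Φ (top g))
  Φ-top-h = trans (functional-cong k (Φ-cong top-h))
    (trans (Φ-increment k (top g)) (+-comm (functional k (Φ (top g))) (jump k)))

module _ {s t g h} (h≈sg : h V.≈ s V.∙ g) (fh≈tfg : shear h V.≈ t V.∙ shear g) where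

  shear-satisfies : Satisfies (λ _ → 0#) s → Satisfies jump t
  shear-satisfies sat k top≗ = begin
    functional k t            ≡⟨ functional-difference k {s} {t} {g} {h} h≈sg fh≈tfg top-s≗ ⟩
    functional k s + jump k   ≡⟨ cong (_+ jump k) (sat k top-s≗) ⟩
    0# + jump k               ≡⟨ +-identityˡ (jump k) ⟩
    jump k                    ∎
    where
    open ≡-Reasoning
    top-s≗ : top s ≗ direction k
    top-s≗ i = trans (sym (top-difference {s} {t} {g} {h} h≈sg fh≈tfg i)) (top≗ i)

  unshear-satisfies : Satisfies jump t → Satisfies (λ _ → 0#) s
  unshear-satisfies sat k top≗ = +-cancelʳ (jump k) (functional k s) 0# (begin
    functional k s + jump k   ≡⟨ functional-difference k {s} {t} {g} {h} h≈sg fh≈tfg top≗ ⟨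
    functional k t            ≡⟨ sat k (λ i → trans (top-difference {s} {t} {g} {h} h≈sg fh≈tfg i) (top≗ i)) ⟩
    jump k                    ≡⟨ +-identityˡ (jump k) ⟨
    0# + jump k               ∎)
    where open ≡-Reasoning

shear-cong : ∀ {u v} → u V.≈ v → shear u V.≈ shear v
shear-cong u≈v = V.∙-cong u≈v (Φ-cong λ i → u≈v (i ↑ˡ 6))

shear-injective : Injective V._≈_ V._≈_ shear
shear-injective {u} {v} fu≈fv = V.∙-cancelʳ (Φ (top v)) u v
  (V.≈-trans (V.∙-congˡ {u} (V.≈-sym (Φ-cong top-u≗top-v))) fu≈fv)
  where
  top-u≗top-v : top u ≗ top v
  top-u≗top-v i = trans (sym (top-shear u i)) (trans (fu≈fv (i ↑ˡ 6)) (top-shear v i))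

shear-isomorphism : Cay _ S₀ ≅ Cay _ S₁
shear-isomorphism = shear , record
  { isOrderMonomorphism = record
    { isOrderHomomorphism = record
      { cong = shear-cong
      ; mono = λ {g} {h} (s , (p , q) , h≈sg) →
          let t      = shear h V.// shear g
              fh≈tfg = V.≈-sym (V.//-rightDividesˡ (shear g) (shear h))
          in t ,
             ( shear-satisfies {s} {t} {g} {h} h≈sg fh≈tfg p
             -- The condition on the inverse is the same lemma for the reversed edge, from `h` to
             -- `g`.
             , shear-satisfies {s V.⁻¹} {t V.⁻¹} {h} {g} (flip {h} {s} h≈sg) (flip {shear h} {t} fh≈tfg) q) ,
             fh≈tfg
      }
    ; injective = shear-injective
    ; cancel = λ {g} {h} (t , (p , q) , fh≈tfg) →
        let s    = h V.// g
            h≈sg = V.≈-sym (V.//-rightDividesˡ g h)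
        in s ,
           ( unshear-satisfies {s} {t} {g} {h} h≈sg fh≈tfg p
           , unshear-satisfies {s V.⁻¹} {t V.⁻¹} {h} {g} (flip {h} {s} h≈sg) (flip {shear h} {t} fh≈tfg) q) ,
           h≈sg
    }
  ; surjective = λ v →
      let u , fu≈v = finite-injective⇒surjective ([ℤ/ 3 ]^ 10) shear-cong shear-injective v
      in u , λ z≈u → V.≈-trans (shear-cong z≈u) fu≈v
  }
  where
  flip : ∀ {h s g} → h V.≈ s V.∙ g → g V.≈ s V.⁻¹ V.∙ h
  flip {h} {s} {g} h≈sg = V.y≈x\\z s g h (V.≈-sym h≈sg)

-- The subgroup (ℤ/3)⁴ × 0

Flat : V.Carrier → Set
Flat v = ∀ i → low v i ≡ 0#

Flat-⁻¹ : ∀ {v} → Flat v → Flat (v V.⁻¹)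
Flat-⁻¹ flat i = cong -_ (flat i)

Flat-// : ∀ {u v} → Flat u → Flat v → Flat (u V.// v)
Flat-// flat-u flat-v i = cong₂ _-_ (flat-u i) (flat-v i)

Flat-sum : ∀ {n} {t : Fin n → V.Carrier} → (∀ j → Flat (t j)) → Flat (sum V.rawMonoid t)
Flat-sum {zero}  flat i = refl
Flat-sum {suc n} flat i = cong₂ _+_ (flat zero i) (Flat-sum (flat ∘ suc) i)

Flat⇒functional≡0 : ∀ {v} → Flat v → ∀ k → functional k v ≡ 0#
Flat⇒functional≡0 flat (origin i) = flat i
Flat⇒functional≡0 flat (axis i)   =
  cong₂ _-_ (sum-cong-≗ {4} {y = λ _ → 0#} λ j → flat (j ↑ˡ 2)) (flat (i ↑ˡ 2))
Flat⇒functional≡0 flat (coaxis i) = flat (i ↑ˡ 2)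

Flat⇒∈S₀ : ∀ {v} → Flat v → SymmetricSubset.members S₀ v
Flat⇒∈S₀ {v} flat = (λ k _ → Flat⇒functional≡0 {v} flat k) ,
  (λ k _ → Flat⇒functional≡0 {v V.⁻¹} (Flat-⁻¹ {v} flat) k)

embed : A.Carrier → V.Carrier
embed a = a ++ replicate 6 0#

embed-flat : ∀ a → Flat (embed a)
embed-flat a = lookup-++ʳ a (replicate 6 0#)

top-embed : ∀ a → top (embed a) ≗ a
top-embed a = lookup-++ˡ a (replicate 6 0#)

embed-cong : ∀ {a b} → a ≗ b → embed a V.≈ embed b
embed-cong {a} {b} a≗b = ++-cong a b a≗b (λ _ → refl)

top≗0∧Flat⇒≈ε : ∀ {v} → top v ≗ A.ε → Flat v → v V.≈ V.ε
top≗0∧Flat⇒≈ε {v} top≗0 flat k = subst (λ k → v k ≡ 0#) (join-splitAt 4 6 k)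
  ([_,_] {C = λ s → v (join 4 6 s) ≡ 0#} top≗0 flat (splitAt 4 k))

-- The trace identity

∑-unit : ∀ k → ∑ (λ j → unit j k) ≡ suc zero
∑-unit = from-yes (all? λ k → ∑ (λ j → unit j k) ≟ suc zero)

-- β is the transpose of L.
trace-contradiction : (β : Fin 4 → Fin 4 → 𝔽₃) → (∀ j → ∑ (β j) - β j j ≡ 0#) →
  ¬ (∀ i → ∑ (λ j → β j i) - β i i ≡ suc zero)
trace-contradiction β rows columns =
  contradiction (+-cancelʳ (∑ λ i → β i i) 0# (suc zero) 0+T≡1+T) λ ()
  where
  open ≡-Reasoning

  restore : ∀ x y {z} → x - y ≡ z → x ≡ z + y
  restore x y x-y≡z = trans (sym (//-rightDividesˡ y x)) (cong (_+ y) x-y≡z)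

  0+T≡1+T : 0# + (∑ λ i → β i i) ≡ suc zero + (∑ λ i → β i i)
  0+T≡1+T = begin
    0# + (∑ λ i → β i i)          ≡⟨ ∑-distrib-+ {4} (λ _ → 0#) (λ j → β j j) ⟨
    (∑ λ j → 0# + β j j)          ≡⟨ sum-cong-≗ (λ j → restore (∑ (β j)) (β j j) (rows j)) ⟨
    -- Exchanging the sums is tr (M L) = tr (L M), with tr L added to both sides.
    (∑ λ j → ∑ λ i → β j i)       ≡⟨ ∑-comm β ⟩
    (∑ λ i → ∑ λ j → β j i)       ≡⟨ sum-cong-≗ (λ i → restore (∑ λ j → β j i) (β i i) (columns i)) ⟩
    -- The four ones add up to 4 = 1 in ℤ/3, by computation.
    (∑ λ i → suc zero + β i i)    ≡⟨ ∑-distrib-+ {4} (λ _ → suc zero) (λ i → β i i) ⟩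
    suc zero + (∑ λ i → β i i)    ∎

-- Automorphisms taking (ℤ/3)⁴ × 0 into S₁

module _ {α : V.Carrier → V.Carrier} (α-automorphism : IsAutomorphism ([ℤ/ 3 ]^ 10) α)
         (α-flat : ∀ {v} → Flat v → Satisfies jump (α v)) where
  open GroupMorphisms V.rawGroup V.rawGroup
  open IsGroupIsomorphism α-automorphism

  -- Once the top of `α v` vanishes, the `origin` conditions kill its remaining coordinates, and `α`
  -- is injective.
  α-kernel : ∀ {v} → Flat v → top (α v) ≗ A.ε → v V.≈ V.ε
  α-kernel {v} flat top≗0 = injective (V.≈-trans
    (top≗0∧Flat⇒≈ε {α v} top≗0 (λ i → α-flat {v} flat (origin i) top≗0)) (V.≈-sym ε-homo))

  α-// : ∀ u v → α (u V.// v) V.≈ α u V.// α v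
  α-// u v = V.≈-trans (∙-homo u (v V.⁻¹)) (V.∙-congˡ {α u} (⁻¹-homo v))

  α-top : A.Carrier → A.Carrier
  α-top a = top (α (embed a))

  -- By `α-kernel` applied to a difference. With finiteness `α-top` is bijective, so the image of
  -- (ℤ/3)⁴ × 0 is the graph of L.
  α-top-injective : Injective A._≈_ A._≈_ α-top
  α-top-injective {a} {b} eq i = begin
    a i               ≡⟨ top-embed a i ⟨
    top (embed a) i   ≡⟨ V.x∙y⁻¹≈ε⇒x≈y (embed a) (embed b) (α-kernel {embed a V.// embed b} difference-flat top≗0) (i ↑ˡ 6) ⟩
    top (embed b) i   ≡⟨ top-embed b i ⟩
    b i               ∎
    where
    open ≡-Reasoning
    difference-flat : Flat (embed a V.// embed b)
    difference-flat = Flat-// {embed a} {embed b} (embed-flat a) (embed-flat b)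

    top≗0 : top (α (embed a V.// embed b)) ≗ A.ε
    top≗0 j = trans (α-// (embed a) (embed b) (j ↑ˡ 6))
      (trans (cong (_- α-top b j) (eq j)) (A.inverseʳ (α-top b) j))

  preimage : ∀ j → ∃ λ a → α-top a ≗ unit j
  preimage j = finite-injective⇒surjective ([ℤ/ 3 ]^ 4)
    (λ a≗b i → ⟦⟧-cong (embed-cong a≗b) (i ↑ˡ 6)) α-top-injective (unit j)

  -- The image of `basis j` lies over eⱼ, so its `mid` coordinates are the first four entries of
  -- column j of L.
  basis : Fin 4 → V.Carrier
  basis j = embed (proj₁ (preimage j))

  -- The image lies over 1 - eᵢ, since the unit vectors sum to 1.
  cobasis : Fin 4 → V.Carrier
  cobasis i = sum V.rawMonoid basis V.// basis i

  cobasis-flat : ∀ i → Flat (cobasis i)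
  cobasis-flat i = Flat-// {sum V.rawMonoid basis} {basis i}
    (Flat-sum {t = basis} λ j → embed-flat (proj₁ (preimage j))) (embed-flat (proj₁ (preimage i)))

  α-cobasis : ∀ i → α (cobasis i) V.≈ sum V.rawMonoid (α ∘ basis) V.// α (basis i)
  α-cobasis i = V.≈-trans (α-// (sum V.rawMonoid basis) (basis i))
    (V.∙-congʳ {α (basis i) V.⁻¹} (sum-homo V.group V.group isGroupHomomorphism basis))

  α-impossible : ⊥
  α-impossible = trace-contradiction (λ j → mid (α (basis j)))
    (λ j → α-flat {basis j} (embed-flat (proj₁ (preimage j))) (axis j) (proj₂ (preimage j)))
    -- By additivity, coordinate i of L (1 - eᵢ) is row i of L summed without its diagonal entry;
    -- the `coaxis i` condition makes it 1.
    (λ i → trans (sym (α-cobasis i (4 ↑ʳ (i ↑ˡ 2))))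
      (α-flat {cobasis i} (cobasis-flat i) (coaxis i) (top-cobasis i)))
    where
    top-cobasis : ∀ i → top (α (cobasis i)) ≗ direction (coaxis i)
    top-cobasis i k = trans (α-cobasis i (k ↑ˡ 6)) (cong₂ _-_
      (trans (sum-cong-≗ {4} λ j → proj₂ (preimage j) k) (∑-unit k))
      (proj₂ (preimage i) k))

corollary1p4 : ¬ IsCIGroup ([ℤ/ 3 ]^ 10)
corollary1p4 isCI =
  let α , α-automorphism , αS₀⊆S₁ , _ = isCI S₀ S₁ shear-isomorphism
  in α-impossible α-automorphism λ {v} flat → proj₁ (αS₀⊆S₁ (v , Flat⇒∈S₀ {v} flat , V.≈-refl {α v}))
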